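{- For a set of patterns $\{\rho_1,\rho_2\}$, let $\mathrm{a}_{n,k}^{\mathrm{dasc}}(\rho_1,\rho_2)$ (respectively $\mathrm{a}_{n,k}^{\mathrm{ddes}}(\rho_1,\rho_2)$) denote the number of permutations of $\{1,\dots,n\}$ that avoid both $\rho_1$ and $\rho_2$ and have exactly $k$ double ascents (respectively $k$ double descents). Then for all integers $n,k\ge 0$, $$\mathrm{a}_{n,k}^{\mathrm{dasc}}(132,213)=\mathrm{a}_{n,k}^{\mathrm{ddes}}(132,213)=\mathrm{a}_{n,k}^{\mathrm{dasc}}(213,231)=\mathrm{a}_{n,k}^{\mathrm{ddes}}(213,231),$$ and, as formal power series, $$\sum_{n \geq 0} \sum_{k \geq 0} \mathrm{a}_{n,k}^{\mathrm{ddes}}(132,213)\,q^kz^n=\dfrac{1-qz}{1-z-z^2-qz+qz^2}.$$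
   Context: $\mathcal{S}_n$ is the set of permutations $\pi=\pi_1\cdots\pi_n$ of $\{1,\dots,n\}$; $\mathcal{S}_0$ consists of the empty permutation, which has no double ascents or double descents and avoids every nonempty pattern. For $\rho\in\mathcal{S}_m$, $\pi\in\mathcal{S}_n$ contains $\rho$ if there are indices $1\le i_1<\cdots<i_m\le n$ such that $\pi_{i_a}<\pi_{i_b}$ if and only if $\rho_a<\rho_b$; otherwise $\pi$ avoids $\rho$. The number of double ascents is $\mathrm{dasc}(\pi)=|\{i:\pi_i<\pi_{i+1}<\pi_{i+2}\}|$ and the number of double descents is $\mathrm{ddes}(\pi)=|\{i:\pi_i>\pi_{i+1}>\pi_{i+2}\}|$, where $1\le i\le n-2$. -}

module Defs where

open import Data.Fin.Base using (Fin; toℕ; _<_)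
open import Data.Fin.Patterns using (0F; 1F; 2F)
open import Data.Fin.Properties using (all?; any?; _<?_; _≟_)
open import Data.Integer.Base as ℤ using (ℤ; +_; 0ℤ; 1ℤ)
open import Data.Integer.Properties using (+-*-semiring)
open import Data.List.Base using (List; []; _∷_; length; filter; allFin; cartesianProductWith)
open import Data.Nat.Base as ℕ using (ℕ; zero; suc; _∸_)
import Data.Nat.Properties as ℕₚ
open import Data.Product.Base using (∃-syntax; _×_; _,_)
open import Data.Vec.Base using (Vec; []; _∷_; lookup)
open import Data.Vec.Relation.Unary.AllPairs using (allPairs?)
open import Data.Vec.Relation.Unary.Unique.Propositional using (Unique)
open import Function.Bundles using (_⇔_; mk⇔; module Equivalence)
open import Relation.Binary.PropositionalEquality.Core using (_≡_)
open import Relation.Nullary.Decidable using (Dec; ¬?; _×-dec_; _→-dec_; map′)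
open import Relation.Nullary.Negation using (¬_)
open import Algebra.Properties.Semiring.Sum +-*-semiring using (sum⁺-syntax)

-- A permutation π₁⋯πₙ is written in one-line notation with the values shifted
-- down by one, i.e. as a word over Fin n.  A word of length n over Fin n
-- without repeated letters uses every letter exactly once.

Word : ℕ → Set
Word n = Vec (Fin n) n

IsPermutation : ∀ {n} → Word n → Set
IsPermutation = Unique

isPermutation? : ∀ {n} (π : Word n) → Dec (IsPermutation π)
isPermutation? = allPairs? (λ x y → ¬? (x ≟ y))

-- The vector i lists the positions i₁ < ⋯ < iₘ of an occurrence of ρ in π.

Increasing : ∀ {n m} → Vec (Fin n) m → Set
Increasing i = ∀ a b → a < b → lookup i a < lookup i b

Occurrence : ∀ {m n} → Word m → Word n → Vec (Fin n) m → Set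
Occurrence ρ π i =
  Increasing i ×
  (∀ a b → lookup π (lookup i a) < lookup π (lookup i b) ⇔ lookup ρ a < lookup ρ b)

Contains : ∀ {m n} → Word m → Word n → Set
Contains ρ π = ∃[ i ] Occurrence ρ π i

Avoids : ∀ {m n} → Word m → Word n → Set
Avoids ρ π = ¬ Contains ρ π

private
  _⇔-dec_ : ∀ {A B : Set} → Dec A → Dec B → Dec (A ⇔ B)
  A? ⇔-dec B? =
    map′ (λ (f , g) → mk⇔ f g) (λ e → Equivalence.to e , Equivalence.from e)
         ((A? →-dec B?) ×-dec (B? →-dec A?))

  anyVec? : ∀ {n} m {P : Vec (Fin n) m → Set} →
            (∀ v → Dec (P v)) → Dec (∃[ v ] P v)
  anyVec? zero    P? = map′ ([] ,_) (λ { ([] , p) → p }) (P? [])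
  anyVec? (suc m) P? =
    map′ (λ (x , v , p) → x ∷ v , p) (λ { (x ∷ v , p) → x , v , p })
         (any? (λ x → anyVec? m (λ v → P? (x ∷ v))))

avoids? : ∀ {m n} (ρ : Word m) (π : Word n) → Dec (Avoids ρ π)
avoids? ρ π = ¬? (anyVec? _ λ i →
  all? (λ a → all? (λ b → (a <? b) →-dec (lookup i a <? lookup i b)))
  ×-dec
  all? (λ a → all? (λ b →
    (lookup π (lookup i a) <? lookup π (lookup i b)) ⇔-dec (lookup ρ a <? lookup ρ b))))

p132 p213 p231 : Word 3
p132 = 0F ∷ 2F ∷ 1F ∷ []
p213 = 1F ∷ 0F ∷ 2F ∷ []
p231 = 1F ∷ 2F ∷ 0F ∷ []

-- The triples (πᵢ , πᵢ₊₁ , πᵢ₊₂), one for each i with 1 ≤ i ≤ n - 2.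

consecutiveTriples : ∀ {A : Set} {n} → Vec A n → List (A × A × A)
consecutiveTriples (x ∷ y ∷ z ∷ w) = (x , y , z) ∷ consecutiveTriples (y ∷ z ∷ w)
consecutiveTriples _               = []

ascending? : ∀ {n} ((x , y , z) : Fin n × Fin n × Fin n) → Dec (x < y × y < z)
ascending? (x , y , z) = (x <? y) ×-dec (y <? z)

descending? : ∀ {n} ((x , y , z) : Fin n × Fin n × Fin n) → Dec (y < x × z < y)
descending? (x , y , z) = (y <? x) ×-dec (z <? y)

dasc ddes : ∀ {n} → Word n → ℕ
dasc π = length (filter ascending? (consecutiveTriples π))
ddes π = length (filter descending? (consecutiveTriples π))

-- All words of length m over Fin n, each listed once.

words : ∀ n m → List (Vec (Fin n) m)
words n zero    = [] ∷ []
words n (suc m) = cartesianProductWith _∷_ (allFin n) (words n m)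

Counted : (stat : ∀ {n} → Word n → ℕ) (k : ℕ) →
          ∀ {m₁ m₂ n} → Word m₁ → Word m₂ → Word n → Set
Counted stat k ρ₁ ρ₂ π = IsPermutation π × Avoids ρ₁ π × Avoids ρ₂ π × stat π ≡ k

counted? : (stat : ∀ {n} → Word n → ℕ) (k : ℕ) →
           ∀ {m₁ m₂ n} (ρ₁ : Word m₁) (ρ₂ : Word m₂) (π : Word n) →
           Dec (Counted stat k ρ₁ ρ₂ π)
counted? stat k ρ₁ ρ₂ π =
  isPermutation? π ×-dec avoids? ρ₁ π ×-dec avoids? ρ₂ π ×-dec (stat π ℕₚ.≟ k)

countAvoiders : (stat : ∀ {n} → Word n → ℕ) (n k : ℕ) →
                ∀ {m₁ m₂} → Word m₁ → Word m₂ → ℕ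
countAvoiders stat n k ρ₁ ρ₂ = length (filter (counted? stat k ρ₁ ρ₂) (words n n))

a-dasc a-ddes : (n k : ℕ) → ∀ {m₁ m₂} → Word m₁ → Word m₂ → ℕ
a-dasc = countAvoiders dasc
a-ddes = countAvoiders ddes

-- Formal power series in z and q over ℤ: F n k is the coefficient of qᵏ zⁿ.

Series : Set
Series = ℕ → ℕ → ℤ

infix  4 _≈_ _≈_/_
infixl 6 _+_ _-_
infixl 7 _*_

_≈_ : Series → Series → Set
F ≈ G = ∀ n k → F n k ≡ G n k

_+_ _-_ _*_ : Series → Series → Series
(F + G) n k = F n k ℤ.+ G n k
(F - G) n k = F n k ℤ.- G n k
(F * G) n k = ∑[ i ≤ n ] ∑[ j ≤ k ] (F (toℕ i) (toℕ j) ℤ.* G (n ∸ toℕ i) (k ∸ toℕ j))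

1# z q : Series
1# 0 0 = 1ℤ
1# _ _ = 0ℤ
z  1 0 = 1ℤ
z  _ _ = 0ℤ
q  0 1 = 1ℤ
q  _ _ = 0ℤ

-- F is the fraction N / D: the denominator D is invertible and F = N D⁻¹.

_≈_/_ : Series → Series → Series → Set
F ≈ N / D = ∃[ D⁻¹ ] (D * D⁻¹ ≈ 1# × F ≈ N * D⁻¹)

-- The generating function ∑ₙ ∑ₖ a n k qᵏ zⁿ.

generatingFunction : (ℕ → ℕ → ℕ) → Series
generatingFunction a n k = + a n k

{-# OPTIONS --safe #-}
module Submission where

-- In a permutation avoiding {132, 213} or {213, 231}, the letters after the first one again
-- form such a permutation (up to order isomorphism), and the first letter is the largest if
-- it starts a descent; if it starts an ascent, it is one less than the second letter,
-- respectively the smallest.  So the avoiders of size n + 1 correspond to their words of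
-- ascents and descents, which are all the binary words of length n.  Double ascents and double
-- descents become pairs of equal adjacent letters, so all four statistics have the same
-- distribution.  Let oₙ be the polynomial in q counting the binary words of length n by
-- occurrences of aa, and let eₙ count the words w of length n by occurrences of aa in a w.
-- Then oₙ₊₁ = eₙ + oₙ and eₙ₊₁ = q eₙ + oₙ, so 1 / (1 - z - z² - qz + qz²) = Σ eₙ zⁿ, and
-- multiplying by 1 - qz leaves 1 + Σ oₙ zⁿ⁺¹.

open import Defs
open import Data.Bool.Base using (Bool; true; false; not; _∧_; _xor_; if_then_else_)
open import Data.Fin.Base using (Fin; zero; suc; toℕ; fromℕ; inject₁; punchIn; punchOut; _<_)
open import Data.Fin.Patterns using (0F; 1F; 2F)
open import Data.Fin.Properties using (_<?_; _≟_; <-cmp; toℕ-injective; toℕ-inject₁; ≤fromℕ; punchIn-injective; punchInᵢ≢i; punchIn-mono-≤; punchIn-cancel-≤; punchIn-punchOut)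
open import Data.Integer.Base as ℤ using (ℤ; 0ℤ; 1ℤ) renaming (+_ to pos)
import Data.Integer.Properties as ℤₚ
open import Data.Integer.Solver using (module +-*-Solver)
open import Data.List.Base as List using (List; []; _∷_; _++_; length; filter)
open import Data.List.Membership.Propositional using (_∈_)
open import Data.List.Membership.Propositional.Properties using (∈-++⁺ˡ; ∈-++⁺ʳ; ∈-map⁺; ∈-map⁻; ∈-filter⁺; ∈-filter⁻; ∈-allFin; ∈-cartesianProductWith⁺)
open import Data.List.Membership.Propositional.Properties.WithK using (unique∧set⇒bag)
open import Data.List.Properties using (filter-++; filter-none; filter-≐; length-++; length-map)
open import Data.List.Relation.Binary.BagAndSetEquality using (∼bag⇒↭)
open import Data.List.Relation.Binary.Disjoint.Propositional using (Disjoint)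
open import Data.List.Relation.Binary.Permutation.Propositional.Properties using (↭-length)
open import Data.List.Relation.Unary.All as ListAll using ([]; _∷_)
open import Data.List.Relation.Unary.AllPairs using ([]; _∷_)
open import Data.List.Relation.Unary.Any using (here)
import Data.List.Relation.Unary.Unique.Propositional as ListUnique
import Data.List.Relation.Unary.Unique.Propositional.Properties as ListUnique
open import Data.Nat.Base as ℕ using (ℕ; zero; suc; z≤n; s≤s; _∸_)
import Data.Nat.Properties as ℕₚ
open import Data.Product.Base using (_×_; _,_; proj₂; ∃-syntax)
open import Data.Vec.Base using (Vec; []; _∷_; lookup; map; head)
open import Data.Vec.Properties using (lookup-map; ∷-injective; ∷-injectiveʳ)
open import Data.Vec.Relation.Unary.All as All using (All; []; _∷_)
import Data.Vec.Relation.Unary.All.Properties as All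
open import Data.Vec.Relation.Unary.AllPairs using ([]; _∷_)
open import Data.Vec.Relation.Unary.Unique.Propositional using (Unique)
import Data.Vec.Relation.Unary.Unique.Propositional.Properties as Unique
open import Function.Base using (_∘_)
open import Function.Bundles using (_⇔_; mk⇔; module Equivalence)
open import Relation.Binary.Definitions using (tri<; tri≈; tri>)
open import Relation.Binary.PropositionalEquality
open import Relation.Nullary using (¬_; Dec; does; yes; no; contradiction)
open import Relation.Nullary.Decidable using (dec-true; dec-false; does-⇔; ¬?; toWitness)
open import Relation.Unary using (Decidable)
open import Algebra.Properties.Semiring.Sum ℤₚ.+-*-semiring using (sum; sum-cong-≗; sum-replicate-zero; ∑-distrib-+)

-- Permutations with a letter put in front

punchIn-mono-< : ∀ {n} (v : Fin (suc n)) {x y} → x < y → punchIn v x < punchIn v y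
punchIn-mono-< v {x} {y} x<y = ℕₚ.≰⇒> (ℕₚ.<⇒≱ x<y ∘ punchIn-cancel-≤ v y x)

punchIn-cancel-< : ∀ {n} (v : Fin (suc n)) {x y} → punchIn v x < punchIn v y → x < y
punchIn-cancel-< v {x} {y} x<y = ℕₚ.≰⇒> (ℕₚ.<⇒≱ x<y ∘ punchIn-mono-≤ v y x)

v<punchIn⇒v≤ : ∀ {n} (v : Fin (suc n)) x → v < punchIn v x → toℕ v ℕ.≤ toℕ x
v<punchIn⇒v≤ zero    x       _         = z≤n
v<punchIn⇒v≤ (suc v) (suc x) (s≤s v<x) = s≤s (v<punchIn⇒v≤ v x v<x)

v≤⇒punchIn≡suc : ∀ {n} (v : Fin (suc n)) x → toℕ v ℕ.≤ toℕ x → punchIn v x ≡ suc x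
v≤⇒punchIn≡suc zero    x       _         = refl
v≤⇒punchIn≡suc (suc v) (suc x) (s≤s v≤x) = cong suc (v≤⇒punchIn≡suc v x v≤x)

punchIn<v⇒<v : ∀ {n} (v : Fin (suc n)) x → punchIn v x < v → toℕ x ℕ.< toℕ v
punchIn<v⇒<v (suc v) zero    _         = s≤s z≤n
punchIn<v⇒<v (suc v) (suc x) (s≤s x<v) = s≤s (punchIn<v⇒<v v x x<v)

-- `punchIn v` relabels the letters of `p` in order, skipping `v`, so that every `v` is a possible
-- first letter.
insert : ∀ {n} → Fin (suc n) → Word n → Word (suc n)
insert v p = v ∷ map (punchIn v) p

unpunch : ∀ {n m} (v : Fin (suc n)) (xs : Vec (Fin (suc n)) m) → All (v ≢_) xs →
          ∃[ p ] xs ≡ map (punchIn v) p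
unpunch v []       []           = [] , refl
unpunch v (x ∷ xs) (v≢x ∷ v≢xs) with p , refl ← unpunch v xs v≢xs =
  punchOut v≢x ∷ p , cong (_∷ map (punchIn v) p) (sym (punchIn-punchOut v≢x))

unique-map⁻ : ∀ {A B : Set} {f : A → B} {n} (xs : Vec A n) → Unique (map f xs) → Unique xs
unique-map⁻         []       []              = []
unique-map⁻ {f = f} (x ∷ xs) (x∉xs ∷ xs!) =
  All.map (_∘ cong f) (All.map⁻ x∉xs) ∷ unique-map⁻ xs xs!

insert-permutation : ∀ {n} v {p : Word n} → IsPermutation p → IsPermutation (insert v p)
insert-permutation v {p} p! =
  All.map⁺ (All.lookup⁻ λ i → punchInᵢ≢i v (lookup p i) ∘ sym) ∷
  Unique.map⁺ (punchIn-injective v _ _) p!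

permutation-insert : ∀ {n} {π : Word (suc n)} → IsPermutation π →
                     ∃[ v ] ∃[ p ] π ≡ insert v p × IsPermutation p
permutation-insert {π = v ∷ xs} (v∉xs ∷ xs!) with p , refl ← unpunch v xs v∉xs =
  v , p , refl , unique-map⁻ p xs!

-- Pigeonhole by induction: a value other than the first letter has a preimage under `punchIn v`,
-- which occurs in the shorter permutation.
lookup-surjective : ∀ {n} {π : Word n} → IsPermutation π → ∀ x → ∃[ i ] lookup π i ≡ x
lookup-surjective {suc n} π! x with permutation-insert π!
... | v , p , refl , p! with v ≟ x
...   | yes v≡x = zero , v≡x
...   | no  v≢x with i , pᵢ≡ ← lookup-surjective p! (punchOut v≢x) = suc i ,
        trans (lookup-map i (punchIn v) p) (trans (cong (punchIn v) pᵢ≡) (punchIn-punchOut v≢x))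

-- Supplies the third letter of a forbidden pattern whose other two letters are the first two of the
-- word.
lookup-later : ∀ {n} {p : Word (suc n)} → IsPermutation p → ∀ v y → v ≢ y → punchIn v (head p) ≢ y →
               ∃[ i ] lookup (insert v p) (suc (suc i)) ≡ y
lookup-later {p = h ∷ p} p! v y v≢y h≢y with lookup-surjective (insert-permutation v p!) y
... | zero          , eq = contradiction eq v≢y
... | suc zero      , eq = contradiction eq h≢y
... | suc (suc i)   , eq = i , eq

-- Pattern occurrences in extended permutations

avoids-tail : ∀ {m n} (ρ : Word m) {p : Word n} v → Avoids ρ (insert v p) → Avoids ρ p
avoids-tail ρ {p} v avoids (i , inc , iff) = avoids (map suc i ,
    (λ a b a<b → subst₂ _<_ (sym (lookup-map a suc i)) (sym (lookup-map b suc i)) (s≤s (inc a b a<b))) ,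
    λ a b → subst₂ (λ x y → x < y ⇔ lookup ρ a < lookup ρ b) (sym (eq a)) (sym (eq b))
      (mk⇔ (Equivalence.to (iff a b) ∘ punchIn-cancel-< v) (punchIn-mono-< v ∘ Equivalence.from (iff a b))))
  where
  eq : ∀ a → lookup (insert v p) (lookup (map suc i) a) ≡ punchIn v (lookup p (lookup i a))
  eq a = trans (cong (lookup (insert v p)) (lookup-map a suc i)) (lookup-map (lookup i a) (punchIn v) p)

-- The converse implications hold because the letters of ρ are totally ordered.
occurrence : ∀ {m n} {ρ : Word m} (π : Word n) → IsPermutation ρ → ∀ i → Increasing i →
             (∀ a b → lookup ρ a < lookup ρ b → lookup π (lookup i a) < lookup π (lookup i b)) →
             Contains ρ π
occurrence {ρ = ρ} π ρ! i inc mono = i , inc , λ a b → mk⇔ (reflects a b) (mono a b)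
  where
  reflects : ∀ a b → lookup π (lookup i a) < lookup π (lookup i b) → lookup ρ a < lookup ρ b
  reflects a b πa<πb with <-cmp (lookup ρ a) (lookup ρ b)
  ... | tri< ρa<ρb _ _ = ρa<ρb
  ... | tri> _ _ ρb<ρa = contradiction (mono b a ρb<ρa) (ℕₚ.<-asym πa<πb)
  ... | tri≈ _ ρa≡ρb _ with refl ← Unique.lookup-injective ρ! a b ρa≡ρb =
    contradiction πa<πb (ℕₚ.<-irrefl refl)

increasing₃ : ∀ {n} {i j k : Fin n} → i < j → j < k → Increasing (i ∷ j ∷ k ∷ [])
increasing₃ i<j j<k 0F 1F _ = i<j
increasing₃ i<j j<k 0F 2F _ = ℕₚ.<-trans i<j j<k
increasing₃ i<j j<k 1F 2F _ = j<k
increasing₃ i<j j<k 1F 1F (s≤s ())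
increasing₃ i<j j<k 2F 1F (s≤s ())
increasing₃ i<j j<k 2F 2F (s≤s (s≤s ()))

contains-132 : ∀ {n} (π : Word n) {i j k} → i < j → j < k →
               lookup π i < lookup π k → lookup π k < lookup π j → Contains p132 π
contains-132 π {i} {j} {k} i<j j<k x<z z<y =
  occurrence π (toWitness {a? = isPermutation? p132} _) (i ∷ j ∷ k ∷ []) (increasing₃ i<j j<k) λ where
    0F 1F _ → ℕₚ.<-trans x<z z<y
    0F 2F _ → x<z
    2F 1F _ → z<y
    1F 1F (s≤s (s≤s ()))
    1F 2F (s≤s ())
    2F 2F (s≤s ())

contains-213 : ∀ {n} (π : Word n) {i j k} → i < j → j < k →
               lookup π j < lookup π i → lookup π i < lookup π k → Contains p213 π
contains-213 π {i} {j} {k} i<j j<k y<x x<z =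
  occurrence π (toWitness {a? = isPermutation? p213} _) (i ∷ j ∷ k ∷ []) (increasing₃ i<j j<k) λ where
    1F 0F _ → y<x
    0F 2F _ → x<z
    1F 2F _ → ℕₚ.<-trans y<x x<z
    0F 0F (s≤s ())
    2F 0F (s≤s ())
    2F 2F (s≤s (s≤s ()))

contains-231 : ∀ {n} (π : Word n) {i j k} → i < j → j < k →
               lookup π k < lookup π i → lookup π i < lookup π j → Contains p231 π
contains-231 π {i} {j} {k} i<j j<k z<x x<y =
  occurrence π (toWitness {a? = isPermutation? p231} _) (i ∷ j ∷ k ∷ []) (increasing₃ i<j j<k) λ where
    2F 0F _ → z<x
    0F 1F _ → x<y
    2F 1F _ → ℕₚ.<-trans z<x x<y
    0F 0F (s≤s ())
    1F 0F (s≤s ())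
    1F 1F (s≤s (s≤s ()))
    0F 2F ()
    1F 2F ()
    2F 2F ()

-- An occurrence that misses the first position already lies in `p`, so only those starting with `v`
-- have to be excluded, which `first` does.
avoids-insert : ∀ {n} (ρ : Word 3) {p : Word n} {v} → Avoids ρ p →
  (∀ j k → j < k →
     let x = lookup (v ∷ punchIn v (lookup p j) ∷ punchIn v (lookup p k) ∷ []) in
     ¬ (∀ a b → lookup ρ a < lookup ρ b → x a < x b)) →
  Avoids ρ (insert v p)
-- Positions increase, so `zero` can only be the first of the three.
avoids-insert ρ avoids first (zero ∷ zero ∷ _ ∷ [] , inc , iff) = ℕₚ.<-irrefl refl (inc 0F 1F (s≤s z≤n))
avoids-insert ρ avoids first (zero ∷ suc j ∷ zero ∷ [] , inc , iff) with () ← inc 1F 2F (s≤s (s≤s z≤n))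
avoids-insert ρ {p} {v} avoids first (zero ∷ suc j ∷ suc k ∷ [] , inc , iff) =
  first j k (ℕₚ.≤-pred (inc 1F 2F (s≤s (s≤s z≤n)))) λ a b ρa<ρb →
    subst₂ _<_ (eq a) (eq b) (Equivalence.from (iff a b) ρa<ρb)
  where
  eq : ∀ a → lookup (insert v p) (lookup (zero ∷ suc j ∷ suc k ∷ []) a) ≡
             lookup (v ∷ punchIn v (lookup p j) ∷ punchIn v (lookup p k) ∷ []) a
  eq 0F = refl
  eq 1F = lookup-map j (punchIn v) p
  eq 2F = lookup-map k (punchIn v) p
avoids-insert ρ avoids first (suc i ∷ zero ∷ _ ∷ [] , inc , iff) with () ← inc 0F 1F (s≤s z≤n)
avoids-insert ρ avoids first (suc i ∷ suc j ∷ zero ∷ [] , inc , iff) with () ← inc 0F 2F (s≤s z≤n)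
avoids-insert ρ {p} {v} avoids first (suc i ∷ suc j ∷ suc k ∷ [] , inc , iff) =
  avoids (is , (λ a b a<b → ℕₚ.≤-pred (subst₂ _<_ (shift a) (shift b) (inc a b a<b))) ,
    λ a b → mk⇔
      (λ lt → Equivalence.to (iff a b) (subst₂ _<_ (sym (eq a)) (sym (eq b)) (punchIn-mono-< v lt)))
      (λ lt → punchIn-cancel-< v (subst₂ _<_ (eq a) (eq b) (Equivalence.from (iff a b) lt))))
  where
  is = i ∷ j ∷ k ∷ []
  shift : ∀ a → lookup (suc i ∷ suc j ∷ suc k ∷ []) a ≡ suc (lookup is a)
  shift a = lookup-map a suc is
  eq : ∀ a → lookup (insert v p) (lookup (suc i ∷ suc j ∷ suc k ∷ []) a) ≡
             punchIn v (lookup p (lookup is a))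
  eq a = trans (cong (lookup (insert v p)) (shift a)) (lookup-map (lookup is a) (punchIn v) p)

-- Words of ascents and descents

signs : ∀ {m n} → Vec (Fin m) (suc n) → Vec Bool n
signs (x ∷ [])     = []
signs (x ∷ y ∷ xs) = does (x <? y) ∷ signs (y ∷ xs)

does-punchIn-<? : ∀ {n} (v : Fin (suc n)) x y → does (punchIn v x <? punchIn v y) ≡ does (x <? y)
does-punchIn-<? v x y =
  does-⇔ (mk⇔ (punchIn-cancel-< v) (punchIn-mono-< v)) (punchIn v x <? punchIn v y) (x <? y)

signs-map-punchIn : ∀ {m n} v (xs : Vec (Fin m) (suc n)) → signs (map (punchIn v) xs) ≡ signs xs
signs-map-punchIn v (x ∷ [])     = refl
signs-map-punchIn v (x ∷ y ∷ xs) = cong₂ _∷_ (does-punchIn-<? v x y) (signs-map-punchIn v (y ∷ xs))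

-- The flag b tells whether the preceding letter was counted, i.e. differs from c:
-- c = false counts the factors (true, true), c = true the factors (false, false).
doubles : ∀ {n} → Bool → Bool → Vec Bool n → ℕ
doubles c b []      = 0
doubles c b (x ∷ w) = if b ∧ (c xor x) then suc d else d
  where d = doubles c (c xor x) w

dasc-signs : ∀ {n} (π : Word (suc n)) → dasc π ≡ doubles false false (signs π)
dasc-signs (x ∷ [])     = refl
-- The first sign has no predecessor and only sets the flag; `go` continues with that sign as the
-- flag.
dasc-signs (x ∷ y ∷ xs) = go x y xs
  where
  go : ∀ {m n} x y (xs : Vec (Fin m) n) →
       length (filter ascending? (consecutiveTriples (x ∷ y ∷ xs))) ≡
       doubles false (does (x <? y)) (signs (y ∷ xs))
  go x y []       = refl
  go x y (z ∷ xs) with does (x <? y) ∧ does (y <? z)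
  ... | true  = cong suc (go y z xs)
  ... | false = go y z xs

does->? : ∀ {n} {x y : Fin n} → x ≢ y → does (y <? x) ≡ not (does (x <? y))
does->? {x = x} {y} x≢y = does-⇔
  (mk⇔ ℕₚ.<-asym λ x≮y → ℕₚ.≤∧≢⇒< (ℕₚ.≮⇒≥ x≮y) (x≢y ∘ sym ∘ toℕ-injective))
  (y <? x) (¬? (x <? y))

-- Since the letters are distinct, a descent is the negation of an ascent, and double descents are
-- factors (false, false).
ddes-signs : ∀ {n} {π : Word (suc n)} → IsPermutation π → ddes π ≡ doubles true false (signs π)
ddes-signs {π = x ∷ []}     _  = refl
ddes-signs {π = x ∷ y ∷ xs} π! = go x y xs π!
  where
  go : ∀ {m n} x y (xs : Vec (Fin m) n) → Unique (x ∷ y ∷ xs) →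
       length (filter descending? (consecutiveTriples (x ∷ y ∷ xs))) ≡
       doubles true (not (does (x <? y))) (signs (y ∷ xs))
  go x y []       _ = refl
  go x y (z ∷ xs) ((x≢y ∷ _) ∷ yzxs!@((y≢z ∷ _) ∷ _))
    rewrite does->? x≢y | does->? y≢z with not (does (x <? y)) ∧ not (does (y <? z))
  ... | true  = cong suc (go y z xs yzxs!)
  ... | false = go y z xs yzxs!

-- The two ways of extending an avoider

AvoidsBoth : ∀ {m₁ m₂ n} → Word m₁ → Word m₂ → Word n → Set
AvoidsBoth ρ₁ ρ₂ π = Avoids ρ₁ π × Avoids ρ₂ π

-- An avoider p can be extended to the left in exactly two ways: by a letter low p, which
-- creates an ascent, and by the largest letter, which creates a descent.
record BinaryExtension {m₁ m₂} (ρ₁ : Word m₁) (ρ₂ : Word m₂) : Set where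
  field
    low            : ∀ {n} → Word (suc n) → Fin (suc (suc n))
    low<head       : ∀ {n} (p : Word (suc n)) → low p < punchIn (low p) (head p)
    singleton      : AvoidsBoth ρ₁ ρ₂ (zero ∷ [])
    low-avoids     : ∀ {n} {p : Word (suc n)} → IsPermutation p → AvoidsBoth ρ₁ ρ₂ p →
                     AvoidsBoth ρ₁ ρ₂ (insert (low p) p)
    top-avoids     : ∀ {n} {p : Word (suc n)} → AvoidsBoth ρ₁ ρ₂ p →
                     AvoidsBoth ρ₁ ρ₂ (insert (fromℕ _) p)
    ascent⇒low     : ∀ {n v} {p : Word (suc n)} → IsPermutation p → AvoidsBoth ρ₁ ρ₂ (insert v p) →
                     v < punchIn v (head p) → v ≡ low p
    descent⇒top    : ∀ {n v} {p : Word (suc n)} → IsPermutation p → AvoidsBoth ρ₁ ρ₂ (insert v p) →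
                     punchIn v (head p) < v → v ≡ fromℕ _

fromℕ≮ : ∀ {n} (x : Fin (suc n)) → ¬ fromℕ n < x
fromℕ≮ x = ℕₚ.≤⇒≯ (≤fromℕ x)

-- The first letter of 213 lies below the third, so the largest letter cannot play its role.
avoids-213-top : ∀ {n} {p : Word n} → Avoids p213 p → Avoids p213 (insert (fromℕ _) p)
avoids-213-top avoids = avoids-insert p213 avoids λ j k _ lt → fromℕ≮ _ (lt 0F 2F (s≤s (s≤s z≤n)))

-- Otherwise the largest value comes after the second letter and completes the initial descent to a
-- 213.
avoids-213-descent⇒top : ∀ {n v} {p : Word (suc n)} → IsPermutation p → Avoids p213 (insert v p) →
                         punchIn v (head p) < v → v ≡ fromℕ _
avoids-213-descent⇒top {v = v} {p = p@(h ∷ _)} p! avoids h<v with v ≟ fromℕ _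
... | yes v≡top = v≡top
... | no  v≢top with i , eq ← lookup-later p! v (fromℕ _) v≢top
                     (λ h≡top → fromℕ≮ v (subst (_< v) h≡top h<v)) =
  contradiction
    (contains-213 (insert v p) {0F} {1F} {suc (suc i)} (s≤s z≤n) (s≤s (s≤s z≤n)) h<v
      (subst (v <_) (sym eq) (ℕₚ.≤∧≢⇒< (≤fromℕ v) (v≢top ∘ toℕ-injective))))
    avoids

avoids-short : (ρ : Word 3) → Avoids {n = 1} ρ (zero ∷ [])
avoids-short ρ (zero ∷ zero ∷ _ ∷ [] , inc , _) with () ← inc 0F 1F (s≤s z≤n)

extension-132-213 : BinaryExtension p132 p213
extension-132-213 = record
  -- The new letter takes the value of the old head, and `punchIn` raises that head by one: the two
  -- become consecutive values.
  { low         = inject₁ ∘ head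
  ; low<head    = λ p → subst (inject₁ (head p) <_) (sym (punchIn-head p)) (low<suc (head p))
  ; singleton   = avoids-short p132 , avoids-short p213
  ; low-avoids  = λ { {p = p} p! (av₁ , av₂) →
      avoids-insert p132 av₁ (λ j k j<k lt →
        av₁ (first-132 p p! j<k (lt 0F 2F (s≤s z≤n)) (lt 2F 1F (s≤s (s≤s z≤n))))) ,
      avoids-insert p213 av₂ (λ j k j<k lt →
        av₂ (first-213 p p! j<k (lt 1F 0F (s≤s z≤n)) (lt 0F 2F (s≤s (s≤s z≤n))))) }
  ; top-avoids  = λ (av₁ , av₂) →
      avoids-insert p132 av₁ (λ j k _ lt → fromℕ≮ _ (lt 0F 2F (s≤s z≤n))) , avoids-213-top av₂
  ; ascent⇒low  = λ { {p = p} p! (av₁ , _) → ascent p p! av₁ }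
  ; descent⇒top = λ p! (_ , av₂) → avoids-213-descent⇒top p! av₂
  }
  where
  low<suc : ∀ {n} (x : Fin n) → inject₁ x < suc x
  low<suc x = s≤s (ℕₚ.≤-reflexive (toℕ-inject₁ x))

  punchIn-head : ∀ {n} (p : Word (suc n)) → punchIn (inject₁ (head p)) (head p) ≡ suc (head p)
  punchIn-head p = v≤⇒punchIn≡suc _ _ (ℕₚ.≤-reflexive (toℕ-inject₁ (head p)))

  -- A letter above the inserted one is, before relabelling, at least the head of `p`; at a later
  -- position it cannot equal the head.
  above : ∀ {n} {p : Word (suc n)} → IsPermutation p → ∀ {k} → zero {n} < k →
          inject₁ (head p) < punchIn (inject₁ (head p)) (lookup p k) → head p < lookup p k
  above {p = p@(h ∷ _)} p! {k} 0<k lt = ℕₚ.≤∧≢⇒<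
    (subst (ℕ._≤ toℕ (lookup p k)) (toℕ-inject₁ h) (v<punchIn⇒v≤ (inject₁ h) _ lt))
    (ℕₚ.<⇒≢ 0<k ∘ cong toℕ ∘ Unique.lookup-injective p! 0F k ∘ toℕ-injective)

  -- The second letter can replace the inserted one in an occurrence of either pattern.
  first-132 : ∀ {n} (p : Word (suc n)) → IsPermutation p → ∀ {j k} → j < k →
              let v = inject₁ (head p) in
              v < punchIn v (lookup p k) → punchIn v (lookup p k) < punchIn v (lookup p j) →
              Contains p132 p
  first-132 p@(h ∷ _) p! {zero}  {k} j<k v<k k<j =
    contradiction (punchIn-cancel-< (inject₁ h) k<j) (ℕₚ.<-asym (above p! j<k v<k))
  first-132 p@(h ∷ _) p! {suc j} {k} j<k v<k k<j =
    contains-132 p {0F} {suc j} {k} (s≤s z≤n) j<k (above p! (ℕₚ.<-trans (s≤s z≤n) j<k) v<k)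
      (punchIn-cancel-< (inject₁ h) k<j)

  first-213 : ∀ {n} (p : Word (suc n)) → IsPermutation p → ∀ {j k} → j < k →
              let v = inject₁ (head p) in
              punchIn v (lookup p j) < v → v < punchIn v (lookup p k) → Contains p213 p
  first-213 p@(h ∷ _) p! {j} {k} j<k j<v v<k
    with j | subst (toℕ (lookup p j) ℕ.<_) (toℕ-inject₁ h) (punchIn<v⇒<v (inject₁ h) _ j<v)
  ... | zero   | h<h = contradiction h<h (ℕₚ.<-irrefl refl)
  ... | suc j′ | j<h =
    contains-213 p {0F} {suc j′} {k} (s≤s z≤n) j<k j<h (above p! (ℕₚ.<-trans (s≤s z≤n) j<k) v<k)

  inject₁<punchIn : ∀ {n} (v : Fin (suc n)) h → v < punchIn v h → inject₁ h < punchIn v h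
  inject₁<punchIn v h v<h =
    subst (inject₁ h <_) (sym (v≤⇒punchIn≡suc v h (v<punchIn⇒v≤ v h v<h))) (low<suc h)

  -- The second letter has the value `h` + 1. If `v` is not `h`, then `v` is smaller and the value
  -- `h` occurs later, so that `v`, `h` + 1, `h` form a 132.
  ascent : ∀ {n v} (p : Word (suc n)) → IsPermutation p → Avoids p132 (insert v p) →
           v < punchIn v (head p) → v ≡ inject₁ (head p)
  ascent {v = v} p@(h ∷ _) p! avoids v<h with v ≟ inject₁ h
  ... | yes v≡ = v≡
  ... | no  v≢ with i , eq ← lookup-later p! v (inject₁ h) v≢
                      (ℕₚ.<⇒≢ (inject₁<punchIn v h v<h) ∘ cong toℕ ∘ sym) =
    contradiction
      (contains-132 (insert v p) {0F} {1F} {suc (suc i)} (s≤s z≤n) (s≤s (s≤s z≤n))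
        (subst (v <_) (sym eq) v<low) (subst (_< punchIn v h) (sym eq) (inject₁<punchIn v h v<h)))
      avoids
    where
    v<low : v < inject₁ h
    v<low = ℕₚ.≤∧≢⇒<
      (subst (toℕ v ℕ.≤_) (sym (toℕ-inject₁ h)) (v<punchIn⇒v≤ v h v<h)) (v≢ ∘ toℕ-injective)

extension-213-231 : BinaryExtension p213 p231
extension-213-231 = record
  { low         = λ _ → zero
  ; low<head    = λ _ → s≤s z≤n
  ; singleton   = avoids-short p213 , avoids-short p231
  ; low-avoids  = λ _ (av₁ , av₂) →
      avoids-insert p213 av₁ (λ j k _ lt → ℕₚ.n≮0 (lt 1F 0F (s≤s z≤n))) ,
      avoids-insert p231 av₂ (λ j k _ lt → ℕₚ.n≮0 (lt 2F 0F (s≤s z≤n)))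
  ; top-avoids  = λ (av₁ , av₂) →
      avoids-213-top av₁ , avoids-insert p231 av₂ (λ j k _ lt → fromℕ≮ _ (lt 0F 1F (s≤s (s≤s z≤n))))
  ; ascent⇒low  = λ { {p = p} p! (_ , av₂) → ascent p p! av₂ }
  ; descent⇒top = λ p! (av₁ , _) → avoids-213-descent⇒top p! av₁
  }
  where
  -- A nonzero `v` starting an ascent leaves the value zero to a later position, which completes a
  -- 231.
  ascent : ∀ {n v} (p : Word (suc n)) → IsPermutation p → Avoids p231 (insert v p) →
           v < punchIn v (head p) → v ≡ zero
  ascent {v = zero}  p         p! avoids v<h = refl
  ascent {v = suc v} p@(h ∷ _) p! avoids v<h
    with i , eq ← lookup-later p! (suc v) zero (λ ()) (λ h≡0 → ℕₚ.n≮0 (subst (suc v <_) h≡0 v<h)) =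
    contradiction
      (contains-231 (insert (suc v) p) {0F} {1F} {suc (suc i)} (s≤s z≤n) (s≤s (s≤s z≤n))
        (subst (_< suc v) (sym eq) (s≤s z≤n)) v<h)
      avoids

-- Avoiders decoded from binary words

module Decoding {m₁ m₂} {ρ₁ : Word m₁} {ρ₂ : Word m₂} (E : BinaryExtension ρ₁ ρ₂) where
  open BinaryExtension E

  decode : ∀ {n} → Vec Bool n → Word (suc n)
  decode []      = zero ∷ []
  decode (x ∷ w) = insert (if x then low (decode w) else fromℕ _) (decode w)

  decode-permutation : ∀ {n} (w : Vec Bool n) → IsPermutation (decode w)
  decode-permutation []      = [] ∷ []
  decode-permutation (x ∷ w) = insert-permutation _ (decode-permutation w)

  decode-avoids : ∀ {n} (w : Vec Bool n) → AvoidsBoth ρ₁ ρ₂ (decode w)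
  decode-avoids []          = singleton
  decode-avoids (true  ∷ w) = low-avoids (decode-permutation w) (decode-avoids w)
  decode-avoids (false ∷ w) = top-avoids (decode-avoids w)

  signs-insert : ∀ {n} v (p : Word (suc n)) →
                 signs (insert v p) ≡ does (v <? punchIn v (head p)) ∷ signs p
  signs-insert v p@(_ ∷ _) = cong (_ ∷_) (signs-map-punchIn v p)

  signs-decode : ∀ {n} (w : Vec Bool n) → signs (decode w) ≡ w
  signs-decode []      = refl
  signs-decode (x ∷ w) = trans (signs-insert _ p) (cong₂ _∷_ (first x) (signs-decode w))
    where
    p = decode w
    first : ∀ x → let v = if x then low p else fromℕ _ in does (v <? punchIn v (head p)) ≡ x
    first true  = dec-true (low p <? punchIn (low p) (head p)) (low<head p)
    first false = dec-false (fromℕ _ <? punchIn (fromℕ _) (head p))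
                            (fromℕ≮ (punchIn (fromℕ _) (head p)))

  -- The tail is an avoider and is decoded by induction. Comparing the first letter with the second
  -- gives the missing sign, and that sign forces the first letter.
  decode-surjective : ∀ {n} {π : Word (suc n)} → IsPermutation π → AvoidsBoth ρ₁ ρ₂ π →
                      ∃[ w ] π ≡ decode w
  decode-surjective {zero}  {zero ∷ []} _ _ = [] , refl
  decode-surjective {suc n} π! (av₁ , av₂) with permutation-insert π!
  ... | v , p , refl , p!
    with w , refl ← decode-surjective p! (avoids-tail ρ₁ v av₁ , avoids-tail ρ₂ v av₂)
       | <-cmp v (punchIn v (head p))
  ...   | tri< v<h _ _ = true  ∷ w , cong (λ u → insert u p) (ascent⇒low p! (av₁ , av₂) v<h)
  ...   | tri≈ _ v≡h _ = contradiction (sym v≡h) (punchInᵢ≢i v (head p))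
  ...   | tri> _ _ h<v = false ∷ w , cong (λ u → insert u p) (descent⇒top p! (av₁ , av₂) h<v)

-- Counting binary words by pairs of equal adjacent letters

bools : ∀ n → List (Vec Bool n)
bools zero    = [] ∷ []
bools (suc n) = List.map (false ∷_) (bools n) ++ List.map (true ∷_) (bools n)

∈-bools : ∀ {n} (w : Vec Bool n) → w ∈ bools n
∈-bools []          = here refl
∈-bools (false ∷ w) = ∈-++⁺ˡ (∈-map⁺ (false ∷_) (∈-bools w))
∈-bools {suc n} (true  ∷ w) = ∈-++⁺ʳ (List.map (false ∷_) (bools n)) (∈-map⁺ (true ∷_) (∈-bools w))

bools-unique : ∀ n → ListUnique.Unique (bools n)
bools-unique zero    = [] ∷ []
bools-unique (suc n) = ListUnique.++⁺
  (ListUnique.map⁺ ∷-injectiveʳ (bools-unique n)) (ListUnique.map⁺ ∷-injectiveʳ (bools-unique n)) disjoint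
  where
  disjoint : Disjoint (List.map (false ∷_) (bools n)) (List.map (true ∷_) (bools n))
  disjoint (∈f , ∈t) with _ , _ , refl ← ∈-map⁻ (false ∷_) ∈f | _ , _ , () ← ∈-map⁻ (true ∷_) ∈t

∈-words : ∀ {n m} (w : Vec (Fin n) m) → w ∈ words n m
∈-words []      = here refl
∈-words (x ∷ w) = ∈-cartesianProductWith⁺ _∷_ (∈-allFin x) (∈-words w)

words-unique : ∀ n m → ListUnique.Unique (words n m)
words-unique n zero    = [] ∷ []
words-unique n (suc m) =
  ListUnique.cartesianProductWith⁺ _∷_ ∷-injective (ListUnique.allFin⁺ n) (words-unique n m)

-- The number of binary words of length n with k pairs of adjacent counted letters, the
-- flag telling whether a counted letter precedes the word.
follow : Bool → ℕ → ℕ → ℕ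
follow _     zero    zero    = 1
follow _     zero    (suc _) = 0
follow false (suc n) k       = follow true n k ℕ.+ follow false n k
follow true  (suc n) zero    = follow false n zero
follow true  (suc n) (suc k) = follow true n k ℕ.+ follow false n (suc k)

length-filter-map : ∀ {A B : Set} {P : B → Set} (P? : Decidable P) (f : A → B) xs →
                    length (filter P? (List.map f xs)) ≡ length (filter (P? ∘ f) xs)
length-filter-map P? f []       = refl
length-filter-map P? f (x ∷ xs) with does (P? (f x))
... | true  = cong suc (length-filter-map P? f xs)
... | false = length-filter-map P? f xs

-- The value is the same for both `c`, because exchanging the two letters exchanges the two kinds of
-- pairs. This equates the distributions of double ascents and double descents.
doubles-count : ∀ c b n k → length (filter (λ w → doubles c b w ℕₚ.≟ k) (bools n)) ≡ follow b n k
doubles-count c b zero    zero    = refl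
doubles-count c b zero    (suc k) = refl
doubles-count c b (suc n) k = begin
  length (filter P? (List.map (false ∷_) (bools n) ++ List.map (true ∷_) (bools n)))
    ≡⟨ cong length (filter-++ P? (List.map (false ∷_) (bools n)) _) ⟩
  length (filter P? (List.map (false ∷_) (bools n)) ++ filter P? (List.map (true ∷_) (bools n)))
    ≡⟨ length-++ (filter P? (List.map (false ∷_) (bools n))) ⟩
  length (filter P? (List.map (false ∷_) (bools n))) ℕ.+
  length (filter P? (List.map (true ∷_) (bools n)))
    ≡⟨ cong₂ ℕ._+_ (length-filter-map P? (false ∷_) (bools n))
                   (length-filter-map P? (true ∷_) (bools n)) ⟩
  count c b false k ℕ.+ count c b true k
    ≡⟨ split c b k ⟩
  follow b (suc n) k ∎
  where
  open ≡-Reasoning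
  P? : (w : Vec Bool (suc n)) → Dec (doubles c b w ≡ k)
  P? w = doubles c b w ℕₚ.≟ k

  count : (c b x : Bool) (k : ℕ) → ℕ
  count c b x k = length (filter (λ w → doubles c b (x ∷ w) ℕₚ.≟ k) (bools n))

  -- A counted letter after a counted letter makes a pair, so zero pairs are impossible here.
  none : ∀ c → length (filter (λ w → suc (doubles {n} c true w) ℕₚ.≟ zero) (bools n)) ≡ 0
  none c = cong length (filter-none (λ w → suc (doubles c true w) ℕₚ.≟ zero)
                                    (ListAll.universal (λ _ ()) (bools n)))

  fewer : ∀ c k → length (filter (λ w → suc (doubles {n} c true w) ℕₚ.≟ suc k) (bools n)) ≡
                  follow true n k
  fewer c k = trans
    (cong length (filter-≐ _ (λ w → doubles c true w ℕₚ.≟ k) (ℕₚ.suc-injective , cong suc) (bools n)))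
    (doubles-count c true n k)

  split : ∀ c b k → count c b false k ℕ.+ count c b true k ≡ follow b (suc n) k
  split true  false k       = cong₂ ℕ._+_ (doubles-count true true n k) (doubles-count true false n k)
  split true  true  zero    = cong₂ ℕ._+_ (none true) (doubles-count true false n zero)
  split true  true  (suc k) = cong₂ ℕ._+_ (fewer true k) (doubles-count true false n (suc k))
  -- Now `true` is the counted letter, but `bools` lists the words starting with `false` first: the
  -- summands are swapped.
  split false false k       = trans
    (cong₂ ℕ._+_ (doubles-count false false n k) (doubles-count false true n k))
    (ℕₚ.+-comm (follow false n k) _)
  split false true  zero    = trans
    (cong₂ ℕ._+_ (doubles-count false false n zero) (none false))
    (ℕₚ.+-identityʳ _)
  split false true  (suc k) = trans
    (cong₂ ℕ._+_ (doubles-count false false n (suc k)) (fewer false k))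
    (ℕₚ.+-comm (follow false n (suc k)) _)

-- Counting avoiders through the bijection

length-filter-bijection : ∀ {A B : Set} {P : A → Set} {Q : B → Set}
  (P? : Decidable P) (Q? : Decidable Q) {xs ys} (f : B → A) → (∀ {v w} → f v ≡ f w → v ≡ w) →
  ListUnique.Unique xs → ListUnique.Unique ys → (∀ x → x ∈ xs) → (∀ y → y ∈ ys) →
  (∀ y → Q y → P (f y)) → (∀ x → P x → ∃[ y ] x ≡ f y × Q y) →
  length (filter P? xs) ≡ length (filter Q? ys)
length-filter-bijection P? Q? {xs} {ys} f f-inj xs! ys! ∈xs ∈ys sound complete = begin
  -- Both lists are free of repetitions and have the same members, so one is a rearrangement of the
  -- other.
  length (filter P? xs)               ≡⟨ ↭-length (∼bag⇒↭ (unique∧set⇒bag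
                                           (ListUnique.filter⁺ P? xs!)
                                           (ListUnique.map⁺ f-inj (ListUnique.filter⁺ Q? ys!))
                                           (mk⇔ to from))) ⟩
  length (List.map f (filter Q? ys))  ≡⟨ length-map f (filter Q? ys) ⟩
  length (filter Q? ys)               ∎
  where
  open ≡-Reasoning
  to : ∀ {x} → x ∈ filter P? xs → x ∈ List.map f (filter Q? ys)
  to {x} x∈ with y , refl , Qy ← complete x (proj₂ (∈-filter⁻ P? {xs = xs} x∈)) =
    ∈-map⁺ f (∈-filter⁺ Q? (∈ys y) Qy)
  from : ∀ {x} → x ∈ List.map f (filter Q? ys) → x ∈ filter P? xs
  from x∈ with y , y∈ , refl ← ∈-map⁻ f x∈ =
    ∈-filter⁺ P? (∈xs (f y)) (sound y (proj₂ (∈-filter⁻ Q? {xs = ys} y∈)))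

-- The coefficients of 1 + Σ oₙ zⁿ⁺¹. The empty permutation is separate because a permutation of
-- size n + 1 has n signs.
avoiderCount : ℕ → ℕ → ℕ
avoiderCount zero    zero    = 1
avoiderCount zero    (suc k) = 0
avoiderCount (suc n) k       = follow false n k

module _ {m₁ m₂} {ρ₁ : Word m₁} {ρ₂ : Word m₂} (E : BinaryExtension ρ₁ ρ₂) where
  open Decoding E

  countAvoiders-suc : (stat : ∀ {n} → Word n → ℕ) (c : Bool) →
    (∀ {n} {π : Word (suc n)} → IsPermutation π → stat π ≡ doubles c false (signs π)) →
    ∀ n k → countAvoiders stat (suc n) k ρ₁ ρ₂ ≡ follow false n k
  countAvoiders-suc stat c stat-signs n k = trans
    (length-filter-bijection (counted? stat k ρ₁ ρ₂) (λ w → doubles c false w ℕₚ.≟ k) decode decode-injective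
      (words-unique (suc n) (suc n)) (bools-unique n) ∈-words ∈-bools sound complete)
    (doubles-count c false n k)
    where
    stat-decode : ∀ w → stat (decode w) ≡ doubles c false w
    stat-decode w = trans (stat-signs (decode-permutation w)) (cong (doubles c false) (signs-decode w))

    decode-injective : ∀ {v w} → decode v ≡ decode w → v ≡ w
    decode-injective {v} {w} eq = trans (sym (signs-decode v)) (trans (cong signs eq) (signs-decode w))

    sound : ∀ w → doubles c false w ≡ k → Counted stat k ρ₁ ρ₂ (decode w)
    sound w eq with av₁ , av₂ ← decode-avoids w =
      decode-permutation w , av₁ , av₂ , trans (stat-decode w) eq

    complete : ∀ π → Counted stat k ρ₁ ρ₂ π → ∃[ w ] π ≡ decode w × doubles c false w ≡ k
    complete π (π! , av₁ , av₂ , eq) with w , refl ← decode-surjective π! (av₁ , av₂) =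
      w , refl , trans (sym (stat-decode w)) eq

a-dasc-132-213 : ∀ n k → a-dasc n k p132 p213 ≡ avoiderCount n k
a-dasc-132-213 zero    zero    = refl
a-dasc-132-213 zero    (suc k) = refl
a-dasc-132-213 (suc n) k       =
  countAvoiders-suc extension-132-213 dasc false (λ {_} {π} _ → dasc-signs π) n k

a-ddes-132-213 : ∀ n k → a-ddes n k p132 p213 ≡ avoiderCount n k
a-ddes-132-213 zero    zero    = refl
a-ddes-132-213 zero    (suc k) = refl
a-ddes-132-213 (suc n) k       = countAvoiders-suc extension-132-213 ddes true ddes-signs n k

a-dasc-213-231 : ∀ n k → a-dasc n k p213 p231 ≡ avoiderCount n k
a-dasc-213-231 zero    zero    = refl
a-dasc-213-231 zero    (suc k) = refl
a-dasc-213-231 (suc n) k       =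
  countAvoiders-suc extension-213-231 dasc false (λ {_} {π} _ → dasc-signs π) n k

a-ddes-213-231 : ∀ n k → a-ddes n k p213 p231 ≡ avoiderCount n k
a-ddes-213-231 zero    zero    = refl
a-ddes-213-231 zero    (suc k) = refl
a-ddes-213-231 (suc n) k       = countAvoiders-suc extension-213-231 ddes true ddes-signs n k

-- Multiplication of power series in q and z

≈-trans : ∀ {A B C} → A ≈ B → B ≈ C → A ≈ C
≈-trans A≈B B≈C n k = trans (A≈B n k) (B≈C n k)

*-congʳ : ∀ {A B} C → A ≈ B → A * C ≈ B * C
*-congʳ C A≈B n k = sum-cong-≗ {suc n} λ i → sum-cong-≗ {suc k} λ j →
  cong (ℤ._* C (n ∸ toℕ i) (k ∸ toℕ j)) (A≈B (toℕ i) (toℕ j))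

*-distribʳ-+ : ∀ C A B → (A + B) * C ≈ A * C + B * C
*-distribʳ-+ C A B n k = trans
  (sum-cong-≗ {suc n} λ i → trans
    (sum-cong-≗ {suc k} λ j →
      ℤₚ.*-distribʳ-+ (C (n ∸ toℕ i) (k ∸ toℕ j)) (A (toℕ i) (toℕ j)) (B (toℕ i) (toℕ j)))
    (∑-distrib-+ (term A i) (term B i)))
  (∑-distrib-+ (λ i → sum (term A i)) (λ i → sum (term B i)))
  where
  term : Series → Fin (suc n) → Fin (suc k) → ℤ
  term F i j = F (toℕ i) (toℕ j) ℤ.* C (n ∸ toℕ i) (k ∸ toℕ j)

-- Follows from additivity applied to (`A - B`) + `B`, which is `A`.
*-distribʳ-- : ∀ C A B → (A - B) * C ≈ A * C - B * C
*-distribʳ-- C A B n k = begin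
  x                      ≡⟨ solve 2 (λ x y → x := (x :+ y) :- y) refl x y ⟩
  (x ℤ.+ y) ℤ.- y        ≡⟨ cong (ℤ._- y) (*-distribʳ-+ C (A - B) B n k) ⟨
  ((A - B + B) * C) n k ℤ.- y ≡⟨ cong (ℤ._- y) (*-congʳ C A-B+B≈A n k) ⟩
  (A * C) n k ℤ.- y      ∎
  where
  open ≡-Reasoning
  open +-*-Solver
  x = ((A - B) * C) n k
  y = (B * C) n k
  A-B+B≈A : A - B + B ≈ A
  A-B+B≈A i j = solve 2 (λ a b → (a :- b) :+ b := a) refl (A i j) (B i j)

-- Multiplication by z and by q as index shifts, which replaces convolutions with polynomials by
-- combinations of neighbouring coefficients.
zshift qshift : Series → Series
zshift A zero    k = 0ℤ
zshift A (suc n) k = A n k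
qshift A n zero    = 0ℤ
qshift A n (suc k) = A n k

zshift-cong : ∀ {A B} → A ≈ B → zshift A ≈ zshift B
zshift-cong A≈B zero    k = refl
zshift-cong A≈B (suc n) k = A≈B n k

qshift-cong : ∀ {A B} → A ≈ B → qshift A ≈ qshift B
qshift-cong A≈B n zero    = refl
qshift-cong A≈B n (suc k) = A≈B n k

-- The summands with i = 0 vanish, and those that remain are the convolution one degree lower.
zshift-* : ∀ A B → zshift A * B ≈ zshift (A * B)
zshift-* A B zero    k = trans (ℤₚ.+-identityʳ _) (sum-replicate-zero (suc k))
zshift-* A B (suc n) k = trans
  (cong (ℤ._+ (A * B) n k) (sum-replicate-zero (suc k)))
  (ℤₚ.+-identityˡ _)

qshift-* : ∀ A B → qshift A * B ≈ qshift (A * B)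
qshift-* A B n zero    = sum-replicate-zero (suc n)
qshift-* A B n (suc k) = sum-cong-≗ {suc n} λ i →
  ℤₚ.+-identityˡ (sum {suc k} λ j → A (toℕ i) (toℕ j) ℤ.* B (n ∸ toℕ i) (k ∸ toℕ j))

*-identityˡ : ∀ A → 1# * A ≈ A
*-identityˡ A n k = begin
  (1ℤ ℤ.* A n k ℤ.+ _) ℤ.+ _
    -- Only the summand with i = j = 0 survives: `x` is the rest of its row, `y` the later rows.
    ≡⟨ cong₂ (λ x y → (1ℤ ℤ.* A n k ℤ.+ x) ℤ.+ y)
         (sum-replicate-zero k)
         (trans (sum-cong-≗ {n} λ i → sum-replicate-zero (suc k)) (sum-replicate-zero n)) ⟩
  (1ℤ ℤ.* A n k ℤ.+ 0ℤ) ℤ.+ 0ℤ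
    ≡⟨ trans (ℤₚ.+-identityʳ _) (ℤₚ.+-identityʳ _) ⟩
  1ℤ ℤ.* A n k
    ≡⟨ ℤₚ.*-identityˡ (A n k) ⟩
  A n k ∎
  where open ≡-Reasoning

z≈zshift1 : z ≈ zshift 1#
z≈zshift1 zero          k       = refl
z≈zshift1 (suc zero)    zero    = refl
z≈zshift1 (suc zero)    (suc k) = refl
z≈zshift1 (suc (suc n)) k       = refl

q≈qshift1 : q ≈ qshift 1#
q≈qshift1 zero    zero          = refl
q≈qshift1 zero    (suc zero)    = refl
q≈qshift1 zero    (suc (suc k)) = refl
q≈qshift1 (suc n) zero          = refl
q≈qshift1 (suc n) (suc k)       = refl

z* : ∀ A → z * A ≈ zshift A
z* A = ≈-trans (*-congʳ A z≈zshift1) (≈-trans (zshift-* 1# A) (zshift-cong (*-identityˡ A)))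

q* : ∀ A → q * A ≈ qshift A
q* A = ≈-trans (*-congʳ A q≈qshift1) (≈-trans (qshift-* 1# A) (qshift-cong (*-identityˡ A)))

z*-assoc : ∀ A B → (z * A) * B ≈ zshift (A * B)
z*-assoc A B = ≈-trans (*-congʳ B (z* A)) (zshift-* A B)

q*-assoc : ∀ A B → (q * A) * B ≈ qshift (A * B)
q*-assoc A B = ≈-trans (*-congʳ B (q* A)) (qshift-* A B)

zz* : ∀ A → (z * z) * A ≈ zshift (zshift A)
zz* A = ≈-trans (z*-assoc z A) (zshift-cong (z* A))

qz* : ∀ A → (q * z) * A ≈ qshift (zshift A)
qz* A = ≈-trans (q*-assoc z A) (qshift-cong (z* A))

qzz* : ∀ A → (q * (z * z)) * A ≈ qshift (zshift (zshift A))
qzz* A = ≈-trans (q*-assoc (z * z) A) (qshift-cong (zz* A))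

numerator-* : ∀ A → (1# - q * z) * A ≈ A - qshift (zshift A)
numerator-* A n k = trans (*-distribʳ-- A 1# (q * z) n k)
  (cong₂ ℤ._-_ (*-identityˡ A n k) (qz* A n k))

denominator-* : ∀ A → (1# - z - z * z - q * z + q * (z * z)) * A ≈
  A - zshift A - zshift (zshift A) - qshift (zshift A) + qshift (zshift (zshift A))
denominator-* A n k =
  trans (*-distribʳ-+ A (1# - z - z * z - q * z) (q * (z * z)) n k) (cong₂ ℤ._+_
    (trans (*-distribʳ-- A (1# - z - z * z) (q * z) n k) (cong₂ ℤ._-_
      (trans (*-distribʳ-- A (1# - z) (z * z) n k) (cong₂ ℤ._-_
        (trans (*-distribʳ-- A 1# z n k) (cong₂ ℤ._-_
          (*-identityˡ A n k)
          (z* A n k)))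
        (zz* A n k)))
      (qz* A n k)))
    (qzz* A n k))

-- The generating function

denominator-inverse :
  (1# - z - z * z - q * z + q * (z * z)) * generatingFunction (follow true) ≈ 1#
denominator-inverse n k = trans (denominator-* G n k) (value n k)
  where
  open +-*-Solver
  G = generatingFunction (follow true)
  value : G - zshift G - zshift (zshift G) - qshift (zshift G) + qshift (zshift (zshift G)) ≈ 1#
  value zero          zero    = refl
  value zero          (suc k) = refl
  value (suc zero)    zero    = refl
  value (suc zero)    (suc zero) = refl
  value (suc zero)    (suc (suc k)) = refl
  -- `a` and `o` are the constant terms of eₙ and oₙ; the two terms with a factor q contribute 0.
  value (suc (suc n)) zero    =
    solve 2 (λ a o → ((((a :+ o) :- o) :- a) :- con 0ℤ) :+ con 0ℤ := con 0ℤ) refl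
      (pos (follow true n 0)) (pos (follow false n 0))
  -- `x` is the coefficient of qᵏ in eₙ₊₁. It stays unexpanded, as its recurrence depends on whether
  -- k is zero; the copies from eₙ₊₂ and from the qz term cancel.
  value (suc (suc n)) (suc k) =
    solve 4 (λ a b o x → ((((x :+ (a :+ o)) :- (b :+ o)) :- a) :- x) :+ b := con 0ℤ) refl
      (pos (follow true n (suc k))) (pos (follow true n k))
      (pos (follow false n (suc k))) (pos (follow true (suc n) k))

-- The recurrence for e, read as oₙ = eₙ₊₁ - q eₙ, with e₀ = 1 giving the constant term.
numerator-quotient : generatingFunction avoiderCount ≈
  (1# - q * z) * generatingFunction (follow true)
numerator-quotient n k = trans (value n k) (sym (numerator-* G n k))
  where
  open +-*-Solver
  G = generatingFunction (follow true)
  value : generatingFunction avoiderCount ≈ G - qshift (zshift G)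
  value zero    zero    = refl
  value zero    (suc k) = refl
  value (suc n) zero    = sym (ℤₚ.+-identityʳ _)
  value (suc n) (suc k) = solve 2 (λ e o → o := (e :+ o) :- e) refl
    (pos (follow true n k)) (pos (follow false n (suc k)))

proposition11 : (∀ (n k : ℕ) →
    a-dasc n k p132 p213 ≡ a-ddes n k p132 p213 ×
    a-ddes n k p132 p213 ≡ a-dasc n k p213 p231 ×
    a-dasc n k p213 p231 ≡ a-ddes n k p213 p231) ×
    generatingFunction (λ n k → a-ddes n k p132 p213)
    ≈ 1# - q * z / 1# - z - z * z - q * z + q * (z * z)
proposition11 =
  (λ n k →
    trans (a-dasc-132-213 n k) (sym (a-ddes-132-213 n k)) ,
    trans (a-ddes-132-213 n k) (sym (a-dasc-213-231 n k)) ,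
    trans (a-dasc-213-231 n k) (sym (a-ddes-213-231 n k))) ,
  generatingFunction (follow true) ,
  denominator-inverse ,
  λ n k → trans (cong pos (a-ddes-132-213 n k)) (numerator-quotient n k)
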